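{- Let $h\in R$ and let $x$ be the binary representation of $h$, and suppose $x\ne 1001000$. Then every occurrence of $1000$ as a contiguous substring of $x$ starts at the first position of $x$ (i.e. $1000$ can occur in $x$ only as a prefix).
   Context: Stern's sequence $(a(n))_{n\ge0}$: $a(0)=0$, $a(1)=1$, $a(2n)=a(n)$, $a(2n+1)=a(n)+a(n+1)$; $s(n)=a(n+1)$ for $n\ge0$. $R$ is the set of record-setters of $s$, i.e. indices $v\ge0$ with $s(i)<s(v)$ for all $i<v$. The binary representation of a positive integer has no leading zeros; $0$ is represented by the string $0$. -}

module Defs where

open import Data.Digit using (Bit; 0b; 1b; Expansion; fromDigits)
open import Data.Fin.Base as Fin using (toℕ)
open import Data.List.Base using ([]; _∷_; _++_; [_]; reverse)
open import Data.List.Properties using (reverse-++)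
open import Data.Nat.Base
open import Data.Nat.DivMod using (_divMod_; result; [m+kn]%n≡m%n; m*n%n≡0)
open import Data.Nat.Induction using (Acc; acc; <-wellFounded)
open import Data.Nat.Properties
open import Data.Product.Base using (∃; _,_)
open import Data.Sum.Base using (_⊎_; inj₁; inj₂)
open import Relation.Binary.PropositionalEquality using (_≡_; refl; sym; trans; cong; cong₂)

-- For n ≥ 2 the recurrence reads a(n) = a(⌊n/2⌋) if n is even and
-- a(n) = a(⌊n/2⌋) + a(⌈n/2⌉) if n is odd; see a-even and a-odd.

aAcc : ∀ n → Acc _<_ n → ℕ
aAcc 0               _        = 0
aAcc 1               _        = 1
aAcc n@(suc (suc m)) (acc rs) with n % 2
... | 0     = aAcc ⌊ n /2⌋ (rs (⌊n/2⌋<n (suc m)))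
... | suc _ = aAcc ⌊ n /2⌋ (rs (⌊n/2⌋<n (suc m))) + aAcc ⌈ n /2⌉ (rs (⌈n/2⌉<n m))

a : ℕ → ℕ
a n = aAcc n (<-wellFounded n)

aAcc-irrelevant : ∀ n (p q : Acc _<_ n) → aAcc n p ≡ aAcc n q
aAcc-irrelevant 0 _ _ = refl
aAcc-irrelevant 1 _ _ = refl
aAcc-irrelevant n@(suc (suc m)) (acc rs) (acc ss) with n % 2
... | 0     = aAcc-irrelevant ⌊ n /2⌋ _ _
... | suc _ = cong₂ _+_ (aAcc-irrelevant ⌊ n /2⌋ _ _) (aAcc-irrelevant ⌈ n /2⌉ _ _)

private
  aAcc-even : ∀ n (p : Acc _<_ n) → n % 2 ≡ 0 → aAcc n p ≡ a ⌊ n /2⌋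
  aAcc-even 0               _        _  = refl
  aAcc-even n@(suc (suc m)) (acc rs) eq with n % 2
  ... | 0 = aAcc-irrelevant ⌊ n /2⌋ _ _

  aAcc-odd : ∀ n (p : Acc _<_ n) → n % 2 ≡ 1 → aAcc n p ≡ a ⌊ n /2⌋ + a ⌈ n /2⌉
  aAcc-odd 1               _        _  = refl
  aAcc-odd n@(suc (suc m)) (acc rs) eq with n % 2
  ... | suc _ = cong₂ _+_ (aAcc-irrelevant ⌊ n /2⌋ _ _) (aAcc-irrelevant ⌈ n /2⌉ _ _)

  ⌊2n/2⌋≡n : ∀ n → ⌊ 2 * n /2⌋ ≡ n
  ⌊2n/2⌋≡n n = trans (cong (λ k → ⌊ n + k /2⌋) (+-identityʳ n)) (sym (n≡⌊n+n/2⌋ n))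

  ⌈2n/2⌉≡n : ∀ n → ⌈ 2 * n /2⌉ ≡ n
  ⌈2n/2⌉≡n n = trans (cong (λ k → ⌈ n + k /2⌉) (+-identityʳ n)) (sym (n≡⌈n+n/2⌉ n))

a-0 : a 0 ≡ 0
a-0 = refl

a-1 : a 1 ≡ 1
a-1 = refl

a-even : ∀ n → a (2 * n) ≡ a n
a-even n = trans
  (aAcc-even (2 * n) _ (trans (cong (_% 2) (*-comm 2 n)) (m*n%n≡0 n 2)))
  (cong a (⌊2n/2⌋≡n n))

a-odd : ∀ n → a (2 * n + 1) ≡ a n + a (n + 1)
a-odd n rewrite +-comm (2 * n) 1 | +-comm n 1 = trans
  (aAcc-odd (1 + 2 * n) _ (trans (cong (λ k → (1 + k) % 2) (*-comm 2 n)) ([m+kn]%n≡m%n 1 n 2)))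
  (cong₂ (λ i j → a i + a (suc j)) (⌈2n/2⌉≡n n) (⌊2n/2⌋≡n n))

s : ℕ → ℕ
s n = a (n + 1)

R : ℕ → Set
R v = ∀ i → i < v → s i < s v

-- Bit strings are written with the most significant bit first, whereas
-- fromDigits expects the least significant digit first.

record IsBinaryRepresentation (h : ℕ) (x : Expansion 2) : Set where
  field
    value           : fromDigits (reverse x) ≡ h
    no-leading-zero : x ≡ [ 0b ] ⊎ ∃ λ w → x ≡ 1b ∷ w

binaryRepresentation : ∀ h → ∃ (IsBinaryRepresentation h)
binaryRepresentation h = go h (<-wellFounded h)
  where
  open IsBinaryRepresentation

  halve : ∀ q (b : Bit) → suc q < toℕ b + suc q * 2
  halve q b = ≤-trans (m<m*n (suc q) 2 (s≤s (s≤s z≤n))) (m≤n+m (suc q * 2) (toℕ b))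

  extend : ∀ q (b : Bit) → ∃ (IsBinaryRepresentation (suc q)) →
           ∃ (IsBinaryRepresentation (toℕ b + suc q * 2))
  extend q b (x , rep) with no-leading-zero rep
  ... | inj₁ refl with () ← value rep
  ... | inj₂ (w , refl) = x ++ [ b ] , record
    { value = trans (cong fromDigits (reverse-++ x [ b ]))
                    (cong (λ k → toℕ b + k * 2) (value rep))
    ; no-leading-zero = inj₂ (w ++ [ b ] , refl)
    }

  go : ∀ h → Acc _<_ h → ∃ (IsBinaryRepresentation h)
  go h (acc rs) with h divMod 2
  ... | result 0 Fin.zero refl =
    [ 0b ] , record { value = refl ; no-leading-zero = inj₁ refl }
  ... | result 0 (Fin.suc Fin.zero) refl =
    [ 1b ] , record { value = refl ; no-leading-zero = inj₂ ([] , refl) }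
  ... | result (suc q) b refl = extend q b (go (suc q) (rs (halve q b)))

{-# OPTIONS --safe #-}

-- Reading a bit string from the left while n is the value read so far, the pair
-- (a(n), a(n+1)) is transformed linearly: the digit 0 maps (p, q) to (p, p + q) and
-- the digit 1 maps it to (p + q, q).  Hence a factor z of x may be replaced by any z′
-- of the same length that is smaller in value and has an entrywise no smaller matrix:
-- this decreases h without decreasing s(h), so no record-setter contains z.
-- Extending a non-initial occurrence of 1000 to the left always leads to such a z;
-- only when x starts with 1001000 does one have to look at the digits on the right.  The
-- replacements z′ below come from a computer search.

module Submission where

open import Defs
open import Data.Digit using (Bit; 0b; 1b; Expansion; fromDigits)
open import Data.Empty using (⊥-elim)
open import Data.Fin.Base using (toℕ)
open import Data.Fin.Patterns using (0F; 1F)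
open import Data.List.Base using ([]; _∷_; _++_; _ʳ++_; foldl; foldr; length; reverse)
open import Data.List.Properties using (foldl-++; reverse-foldr; reverse-involutive; ʳ++-defn)
open import Data.Nat.Base using (ℕ; _+_; _*_; _^_; _≤_; _<_)
open import Data.Nat.Properties
open import Data.Nat.Tactic.RingSolver using (solve-∀)
open import Data.Product.Base using (∃; _×_; _,_; proj₁; proj₂)
open import Data.Sum.Base using (inj₁; inj₂)
open import Relation.Binary.PropositionalEquality using (_≡_; _≢_; refl; sym; trans; cong; cong₂; subst; subst₂; module ≡-Reasoning)
open import Relation.Nullary using (¬_; Dec)
open import Relation.Nullary.Decidable using (True; toWitness; _×-dec_)

-- Values of bit strings

appendBit : ℕ → Bit → ℕ
appendBit n b = toℕ b + n * 2

valueFrom : ℕ → Expansion 2 → ℕ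
valueFrom = foldl appendBit

value : Expansion 2 → ℕ
value = valueFrom 0

-- Both sides are Horner evaluations: a right fold over the reversed string is a left fold over the
-- string.
fromDigits-reverse : ∀ x → fromDigits (reverse x) ≡ value x
fromDigits-reverse x = trans (fromDigits-foldr (reverse x)) (reverse-foldr _ 0 x)
  where
  fromDigits-foldr : ∀ (y : Expansion 2) → fromDigits y ≡ foldr (λ b n → appendBit n b) 0 y
  fromDigits-foldr []      = refl
  fromDigits-foldr (b ∷ y) = cong (λ n → appendBit n b) (fromDigits-foldr y)

valueFrom-shift : ∀ n z → valueFrom n z ≡ n * 2 ^ length z + value z
valueFrom-shift n []      = sym (trans (+-identityʳ (n * 1)) (*-identityʳ n))
valueFrom-shift n (b ∷ z) = begin
  valueFrom (appendBit n b) z                              ≡⟨ valueFrom-shift (appendBit n b) z ⟩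
  (toℕ b + n * 2) * 2 ^ length z + value z                 ≡⟨ regroup (toℕ b) n (2 ^ length z) (value z) ⟩
  n * (2 * 2 ^ length z) + ((toℕ b + 0) * 2 ^ length z + value z)
    ≡⟨ cong (n * (2 * 2 ^ length z) +_) (valueFrom-shift (toℕ b + 0) z) ⟨
  n * (2 * 2 ^ length z) + value (b ∷ z)                   ∎
  where
  open ≡-Reasoning
  regroup : ∀ d n k m → (d + n * 2) * k + m ≡ n * (2 * k) + ((d + 0) * k + m)
  regroup = solve-∀

valueFrom-monoˡ-< : ∀ w {m n} → m < n → valueFrom m w < valueFrom n w
valueFrom-monoˡ-< []      m<n = m<n
valueFrom-monoˡ-< (b ∷ w) m<n = valueFrom-monoˡ-< w (+-monoʳ-< (toℕ b) (*-monoˡ-< 2 m<n))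

-- Equal lengths multiply `n` by the same power of 2, so the values of `z` and `z′` decide.
valueFrom-monoʳ-< : ∀ n z z′ → length z ≡ length z′ → value z′ < value z → valueFrom n z′ < valueFrom n z
valueFrom-monoʳ-< n z z′ len z′<z
  rewrite valueFrom-shift n z | valueFrom-shift n z′ | len = +-monoʳ-< (n * 2 ^ length z′) z′<z

-- Linear action of bit strings on Stern pairs

State : Set
State = ℕ × ℕ

step : State → Bit → State
step (p , q) 0F = p , p + q
step (p , q) 1F = p + q , q

run : State → Expansion 2 → State
run = foldl step

initial : State
initial = 0 , 1

sternState : ℕ → State
sternState n = a n , a (n + 1)

step-stern : ∀ n b → step (sternState n) b ≡ sternState (appendBit n b)
step-stern n 0F rewrite *-comm n 2 = cong₂ _,_ (sym (a-even n)) (sym (a-odd n))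
step-stern n 1F rewrite *-comm n 2 = cong₂ _,_
  (sym (trans (cong a (+-comm 1 (2 * n))) (a-odd n)))
  (sym (trans (cong a (double n)) (a-even (n + 1))))
  where
  double : ∀ n → 1 + 2 * n + 1 ≡ 2 * (n + 1)
  double = solve-∀

run-stern : ∀ n z → run (sternState n) z ≡ sternState (valueFrom n z)
run-stern n []      = refl
run-stern n (b ∷ z) rewrite step-stern n b = run-stern (appendBit n b) z

-- `initial` is `sternState 0`, and the second entry of `sternState n` is `s n`.
s-value : ∀ x → s (value x) ≡ proj₂ (run initial x)
s-value x = sym (cong proj₂ (run-stern 0 x))

-- Monotonicity and comparison of matrices

infix 4 _≼_ _≼?_
_≼_ : State → State → Set
(p , q) ≼ (p′ , q′) = p ≤ p′ × q ≤ q′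

_≼?_ : ∀ σ τ → Dec (σ ≼ τ)
(p , q) ≼? (p′ , q′) = (p ≤? p′) ×-dec (q ≤? q′)

step-mono : ∀ b {σ τ} → σ ≼ τ → step σ b ≼ step τ b
step-mono 0F (p≤ , q≤) = p≤ , +-mono-≤ p≤ q≤
step-mono 1F (p≤ , q≤) = +-mono-≤ p≤ q≤ , q≤

run-mono : ∀ w {σ τ} → σ ≼ τ → run σ w ≼ run τ w
run-mono []      σ≼τ = σ≼τ
run-mono (b ∷ w) σ≼τ = run-mono w (step-mono b σ≼τ)

-- The row vector `(i , j)` times the matrix whose rows are the two states.
combine : ℕ → ℕ → State → State → State
combine i j (p , q) (p′ , q′) = i * p + j * p′ , i * q + j * q′

combine-mono : ∀ i j {σ σ′ τ τ′} → σ ≼ σ′ → τ ≼ τ′ → combine i j σ τ ≼ combine i j σ′ τ′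
combine-mono i j (p≤ , q≤) (r≤ , t≤) =
  +-mono-≤ (*-monoʳ-≤ i p≤) (*-monoʳ-≤ j r≤) , +-mono-≤ (*-monoʳ-≤ i q≤) (*-monoʳ-≤ j t≤)

step-combine : ∀ i j σ τ b → step (combine i j σ τ) b ≡ combine i j (step σ b) (step τ b)
step-combine i j (p , q) (p′ , q′) = λ { 0F → cong₂ _,_ refl (interchange i j p q p′ q′)
                                       ; 1F → cong₂ _,_ (interchange i j p q p′ q′) refl }
  where
  interchange : ∀ i j p q p′ q′ → i * p + j * p′ + (i * q + j * q′) ≡ i * (p + q) + j * (p′ + q′)
  interchange = solve-∀

run-combine : ∀ i j σ τ z → run (combine i j σ τ) z ≡ combine i j (run σ z) (run τ z)
run-combine i j σ τ []      = refl
run-combine i j σ τ (b ∷ z) rewrite step-combine i j σ τ b = run-combine i j (step σ b) (step τ b) z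

-- By linearity, the images of `(1 , 0)` and `(0 , 1)` are the rows of the matrix of `z`.
run-basis : ∀ p q z → run (p , q) z ≡ combine p q (run (1 , 0) z) (run (0 , 1) z)
run-basis p q z = trans (cong (λ σ → run σ z) (cong₂ _,_ (left p q) (right p q)))
                        (run-combine p q (1 , 0) (0 , 1) z)
  where
  left : ∀ p q → p ≡ p * 1 + q * 0
  left = solve-∀
  right : ∀ p q → q ≡ p * 0 + q * 1
  right = solve-∀

Dominates : Expansion 2 → Expansion 2 → Set
Dominates z′ z = run (1 , 0) z ≼ run (1 , 0) z′ × run (0 , 1) z ≼ run (0 , 1) z′

-- Every state is a combination of the basis states with coefficients in ℕ, which preserves the
-- order of the rows.
run-dominates : ∀ {z z′} → Dominates z′ z → ∀ σ → run σ z ≼ run σ z′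
run-dominates {z} {z′} (d₁ , d₂) (p , q) =
  subst₂ _≼_ (sym (run-basis p q z)) (sym (run-basis p q z′)) (combine-mono p q d₁ d₂)

-- Replacing factors of record-setters

RecordString : Expansion 2 → Set
RecordString x = R (value x)

record-unbeaten : ∀ x y → RecordString x → value y < value x → ¬ (proj₂ (run initial x) ≤ proj₂ (run initial y))
record-unbeaten x y rec y<x x≤y =
  <⇒≱ (rec (value y) y<x) (subst₂ _≤_ (sym (s-value x)) (sym (s-value y)) x≤y)

Smaller : Expansion 2 → Expansion 2 → Set
Smaller z′ z = length z ≡ length z′ × value z′ < value z

smaller? : ∀ z′ z → Dec (Smaller z′ z)
smaller? z′ z = (length z ≟ length z′) ×-dec (value z′ <? value z)

-- Nothing stands to the left of `z`, so it suffices to compare the states reached from `initial`.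
-- For concrete strings both conditions are decided by evaluation.
no-dominated-prefix : ∀ z z′ {_ : True (smaller? z′ z)} {_ : True (run initial z ≼? run initial z′)} →
  ∀ w → ¬ RecordString (z ++ w)
no-dominated-prefix z z′ {small} {dom} w rec = record-unbeaten (z ++ w) (z′ ++ w) rec
  (subst₂ _<_ (sym (foldl-++ appendBit 0 z′ w)) (sym (foldl-++ appendBit 0 z w))
    (valueFrom-monoˡ-< w (proj₂ (toWitness small))))
  (proj₂ (subst₂ _≼_ (sym (foldl-++ step initial z w)) (sym (foldl-++ step initial z′ w))
    (run-mono w (toWitness dom))))

foldl-context : ∀ {A : Set} (f : A → Bit → A) e v z w →
  foldl f e (v ʳ++ z ++ w) ≡ foldl f (foldl f (foldl f e (reverse v)) z) w
foldl-context f e v z w = begin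
  foldl f e (v ʳ++ z ++ w)                        ≡⟨ cong (foldl f e) (ʳ++-defn v) ⟩
  foldl f e (reverse v ++ z ++ w)                 ≡⟨ foldl-++ f e (reverse v) (z ++ w) ⟩
  foldl f (foldl f e (reverse v)) (z ++ w)        ≡⟨ foldl-++ f _ z w ⟩
  foldl f (foldl f (foldl f e (reverse v)) z) w   ∎
  where open ≡-Reasoning

dominates? : ∀ z′ z → Dec (Dominates z′ z)
dominates? z′ z = (run (1 , 0) z ≼? run (1 , 0) z′) ×-dec (run (0 , 1) z ≼? run (0 , 1) z′)

-- The digits to the left of the factor are listed in v from right to left, so that
-- matching on v extends the factor to the left by computation alone.
no-dominated-factor : ∀ z z′ {_ : True (smaller? z′ z)} {_ : True (dominates? z′ z)} →
  ∀ v w → ¬ RecordString (v ʳ++ z ++ w)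
no-dominated-factor z z′ {small} {dom} v w rec =
  let len , z′<z = toWitness small in
  record-unbeaten (v ʳ++ z ++ w) (v ʳ++ z′ ++ w) rec
    (subst₂ _<_ (sym (foldl-context appendBit 0 v z′ w)) (sym (foldl-context appendBit 0 v z w))
      (valueFrom-monoˡ-< w (valueFrom-monoʳ-< (value (reverse v)) z z′ len z′<z)))
    (proj₂ (subst₂ _≼_ (sym (foldl-context step initial v z w)) (sym (foldl-context step initial v z′ w))
      (run-mono w (run-dominates {z} {z′} (toWitness dom) (run initial (reverse v))))))

-- Exclusion of non-initial occurrences of 1000

LeadingOne : Expansion 2 → Set
LeadingOne x = ∃ λ t → x ≡ 1b ∷ t

-- The window 0000 slides left over zeros until it meets a 1, at the latest the leading one; this
-- exposes the factor 10000.
no-0000 : ∀ v w → LeadingOne (v ʳ++ 0b ∷ 0b ∷ 0b ∷ 0b ∷ w) → ¬ RecordString (v ʳ++ 0b ∷ 0b ∷ 0b ∷ 0b ∷ w)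
no-0000 []       w (_ , ())
no-0000 (0F ∷ v) w one rec = no-0000 v (0b ∷ w) one rec
no-0000 (1F ∷ v) w _   rec = no-dominated-factor
  (1b ∷ 0b ∷ 0b ∷ 0b ∷ 0b ∷ [])
  -- If `v` is empty, the new string begins with 0; this is harmless, as only values are compared.
  (0b ∷ 1b ∷ 0b ∷ 1b ∷ 0b ∷ []) v w rec

prefix-1001000 : ∀ w → RecordString (1b ∷ 0b ∷ 0b ∷ 1b ∷ 0b ∷ 0b ∷ 0b ∷ w) → w ≡ []
prefix-1001000 [] _ = refl
prefix-1001000 (0F ∷ w) rec = ⊥-elim (no-0000 (1b ∷ 0b ∷ 0b ∷ 1b ∷ []) w (_ , refl) rec)
-- After 1001000 the state is (4, 15). A last digit 1 keeps the second entry 15, a last digit 0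
-- makes it 19, so 144 beats 145.
prefix-1001000 (1F ∷ []) rec = ⊥-elim (record-unbeaten
  (1b ∷ 0b ∷ 0b ∷ 1b ∷ 0b ∷ 0b ∷ 0b ∷ 1b ∷ [])
  (1b ∷ 0b ∷ 0b ∷ 1b ∷ 0b ∷ 0b ∷ 0b ∷ 0b ∷ []) rec (n<1+n 144) (m≤m+n 15 4))
prefix-1001000 (1F ∷ 0F ∷ w) rec = ⊥-elim (no-dominated-prefix
  (1b ∷ 0b ∷ 0b ∷ 1b ∷ 0b ∷ 0b ∷ 0b ∷ 1b ∷ 0b ∷ [])
  (1b ∷ 0b ∷ 0b ∷ 0b ∷ 1b ∷ 1b ∷ 0b ∷ 1b ∷ 0b ∷ []) w rec)
prefix-1001000 (1F ∷ 1F ∷ w) rec = ⊥-elim (no-dominated-prefix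
  (1b ∷ 0b ∷ 0b ∷ 1b ∷ 0b ∷ 0b ∷ 0b ∷ 1b ∷ 1b ∷ [])
  (1b ∷ 0b ∷ 0b ∷ 0b ∷ 1b ∷ 0b ∷ 1b ∷ 0b ∷ 1b ∷ []) w rec)

-- By `no-0000` at most three zeros directly precede 1000. Zero, one or three of them, bounded by a
-- 1, give a dominated factor. Two give 1001000, and the same split on the zeros before it leaves
-- only the case where it starts `x`.
noninitial-1000 : ∀ b v w → let x = (b ∷ v) ʳ++ 1b ∷ 0b ∷ 0b ∷ 0b ∷ w in
  LeadingOne x → RecordString x → x ≡ 1b ∷ 0b ∷ 0b ∷ 1b ∷ 0b ∷ 0b ∷ 0b ∷ []
noninitial-1000 1F v w one rec = ⊥-elim (no-dominated-factor
  (1b ∷ 1b ∷ 0b ∷ 0b ∷ 0b ∷ [])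
  (1b ∷ 0b ∷ 1b ∷ 1b ∷ 0b ∷ []) v w rec)
noninitial-1000 0F [] w (_ , ()) rec
noninitial-1000 0F (1F ∷ v) w one rec = ⊥-elim (no-dominated-factor
  (1b ∷ 0b ∷ 1b ∷ 0b ∷ 0b ∷ 0b ∷ [])
  (1b ∷ 0b ∷ 0b ∷ 1b ∷ 0b ∷ 0b ∷ []) v w rec)
noninitial-1000 0F (0F ∷ []) w (_ , ()) rec
noninitial-1000 0F (0F ∷ 0F ∷ []) w (_ , ()) rec
noninitial-1000 0F (0F ∷ 0F ∷ 0F ∷ v) w one rec = ⊥-elim (no-0000 v _ one rec)
noninitial-1000 0F (0F ∷ 0F ∷ 1F ∷ v) w one rec = ⊥-elim (no-dominated-factor
  (1b ∷ 0b ∷ 0b ∷ 0b ∷ 1b ∷ 0b ∷ 0b ∷ 0b ∷ [])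
  (0b ∷ 1b ∷ 1b ∷ 0b ∷ 1b ∷ 1b ∷ 0b ∷ 0b ∷ []) v w rec)
noninitial-1000 0F (0F ∷ 1F ∷ []) w one rec with refl ← prefix-1001000 w rec = refl
noninitial-1000 0F (0F ∷ 1F ∷ 1F ∷ v) w one rec = ⊥-elim (no-dominated-factor
  (1b ∷ 1b ∷ 0b ∷ 0b ∷ 1b ∷ 0b ∷ 0b ∷ 0b ∷ [])
  (1b ∷ 0b ∷ 1b ∷ 1b ∷ 0b ∷ 1b ∷ 1b ∷ 0b ∷ []) v w rec)
noninitial-1000 0F (0F ∷ 1F ∷ 0F ∷ []) w (_ , ()) rec
noninitial-1000 0F (0F ∷ 1F ∷ 0F ∷ 1F ∷ v) w one rec = ⊥-elim (no-dominated-factor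
  (1b ∷ 0b ∷ 1b ∷ 0b ∷ 0b ∷ 1b ∷ 0b ∷ 0b ∷ 0b ∷ [])
  (1b ∷ 0b ∷ 0b ∷ 1b ∷ 1b ∷ 0b ∷ 1b ∷ 0b ∷ 0b ∷ []) v w rec)
noninitial-1000 0F (0F ∷ 1F ∷ 0F ∷ 0F ∷ []) w (_ , ()) rec
noninitial-1000 0F (0F ∷ 1F ∷ 0F ∷ 0F ∷ 1F ∷ v) w one rec = ⊥-elim (no-dominated-factor
  (1b ∷ 0b ∷ 0b ∷ 1b ∷ 0b ∷ 0b ∷ 1b ∷ 0b ∷ 0b ∷ 0b ∷ [])
  (1b ∷ 0b ∷ 0b ∷ 0b ∷ 1b ∷ 1b ∷ 0b ∷ 1b ∷ 0b ∷ 0b ∷ []) v w rec)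
noninitial-1000 0F (0F ∷ 1F ∷ 0F ∷ 0F ∷ 0F ∷ []) w (_ , ()) rec
noninitial-1000 0F (0F ∷ 1F ∷ 0F ∷ 0F ∷ 0F ∷ 0F ∷ v) w one rec = ⊥-elim (no-0000 v _ one rec)
noninitial-1000 0F (0F ∷ 1F ∷ 0F ∷ 0F ∷ 0F ∷ 1F ∷ v) w one rec = ⊥-elim (no-dominated-factor
  (1b ∷ 0b ∷ 0b ∷ 0b ∷ 1b ∷ 0b ∷ 0b ∷ 1b ∷ 0b ∷ 0b ∷ 0b ∷ [])
  (1b ∷ 0b ∷ 0b ∷ 0b ∷ 0b ∷ 1b ∷ 0b ∷ 1b ∷ 0b ∷ 1b ∷ 0b ∷ []) v w rec)

++-as-ʳ++ : ∀ (u t : Expansion 2) → u ++ t ≡ reverse u ʳ++ t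
++-as-ʳ++ u t = sym (trans (ʳ++-defn (reverse u)) (cong (_++ t) (reverse-involutive u)))

mainTheorem8 : (h : ℕ) → R h →
    (x : Expansion 2) → IsBinaryRepresentation h x →
    x ≢ 1b ∷ 0b ∷ 0b ∷ 1b ∷ 0b ∷ 0b ∷ 0b ∷ [] →
    ∀ u w → x ≡ u ++ (1b ∷ 0b ∷ 0b ∷ 0b ∷ []) ++ w → u ≡ []
mainTheorem8 h h∈R x rep x≢ u w x≡ with IsBinaryRepresentation.no-leading-zero rep
mainTheorem8 h h∈R x rep x≢ []          w x≡ | _ = refl
mainTheorem8 h h∈R x rep x≢ (_ ∷ [])    w () | inj₁ refl
mainTheorem8 h h∈R x rep x≢ (_ ∷ _ ∷ _) w () | inj₁ refl
mainTheorem8 h h∈R x rep x≢ u@(_ ∷ _) w x≡ | inj₂ one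
  -- Reversing `u` exposes the digit just before 1000 as the head `b`.
  with reverse u in eq | trans x≡ (++-as-ʳ++ u _)
... | []    | _    = trans (sym (reverse-involutive u)) (cong reverse eq)
... | b ∷ v | refl = ⊥-elim (x≢ (noninitial-1000 b v w one
      (subst R (trans (sym (IsBinaryRepresentation.value rep)) (fromDigits-reverse x)) h∈R)))
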